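{- Let $\mathcal{K}=\langle K_1,\dots,K_r\rangle$ be an Alexander $r$-tuple of simplicial complexes $K_i\subsetneq 2^V$ on a finite vertex set $V$. Then one of the following holds: (1) $r=2$ and $(K_1,K_2)=(K,K^\circ)$ is an Alexander pair of dual complexes; or (2) $r\ge 3$ and, up to a bijection of $V$ with $[n]$, where $n=|V|$, there are non-negative integers $m_1,\dots,m_r$ with $n=m_1+\cdots+m_r+r-1$ and $K_i=\binom{[n]}{\leqslant m_i}$ for each $i=1,\dots,r$; or (3) $r\ge 3$ and, up to a bijection of $V$ with $[n]\cup C$ for some $n$ and some non-empty set $C$ with $C\cap[n]=\emptyset$, there are non-negative integers $m_1,\dots,m_r$ with $n=m_1+\cdots+m_r+r-1$ and $K_i=\binom{[n]}{\leqslant m_i}\ast\Delta(C)$ for each $i=1,\dots,r$, where $\Delta(C)=2^C$ is the simplex spanned by $C$.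
   Context: $[n]=\{1,\dots,n\}$. A simplicial complex on a finite vertex set $V$ is a subset $K\subseteq 2^V$ with $\emptyset\in K$ that is closed under taking subsets (some $\{v\}$, $v\in V$, may fail to be in $K$). All complexes are assumed proper: $K_i\subsetneq 2^V$. An $r$-tuple $\langle K_1,\dots,K_r\rangle$ of complexes on $V$ is collective $r$-unavoidable if for each ordered collection $(A_1,\dots,A_r)$ of pairwise disjoint subsets of $V$ there exists $i$ with $A_i\in K_i$. It is an Alexander $r$-tuple if it is collective $r$-unavoidable and, for all $A_1\in K_1,\dots,A_r\in K_r$, the set $V\setminus\bigcup_{i=1}^r A_i$ has at least $r-1$ elements. The Alexander dual of $K\subsetneq 2^V$ is $K^\circ=\{F\subseteq V\mid V\setminus F\notin K\}$. $\binom{[n]}{\leqslant m}$ is the complex of all subsets of $[n]$ of cardinality at most $m$. The join of complexes $K,L$ on disjoint vertex sets is $K\ast L=\{A\cup B\mid A\in K, B\in L\}$. -}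

module Defs where

open import Data.Bool using (Bool; false; not; _∨_; T)
open import Data.Fin using (Fin)
open import Data.Fin.Subset using (∣_∣)
open import Data.Nat using (ℕ; _≤_; _∸_)
open import Data.Product using (_×_; ∃-syntax)
open import Data.Sum using (_⊎_; [_,_]′)
open import Data.Unit using (⊤)
open import Data.Vec using (tabulate)
open import Data.Vec.Functional using (foldr)
open import Function using (_∘_; const)
open import Function.Bundles using (_↔_; _⇔_; Inverse)
open import Function.Construct.Identity using (↔-id)
open import Level using (0ℓ)
open import Relation.Binary.PropositionalEquality using (_≢_; _≗_)
open import Relation.Nullary using (¬_)
open import Relation.Unary using (Pred; Decidable)

private
  variable
    V W : Set
    r n : ℕ

-- Elements of 2^V are characteristic functions.  Function extensionality is
-- not available, so equality of subsets is pointwise (_≗_).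

Subset : Set → Set
Subset V = V → Bool

infix 4 _∈_ _⊆_

_∈_ : V → Subset V → Set
x ∈ A = T (A x)

_⊆_ : Subset V → Subset V → Set
A ⊆ B = ∀ {x} → x ∈ A → x ∈ B

∅ : Subset V
∅ = const false

∁ : Subset V → Subset V
∁ A = not ∘ A

⋃ : (Fin r → Subset V) → Subset V
⋃ A x = foldr _∨_ false (λ i → A i x)

PairwiseDisjoint : (Fin r → Subset V) → Set
PairwiseDisjoint A = ∀ {i j} → i ≢ j → ∀ {x} → x ∈ A i → ¬ x ∈ A j

-- A finite set is a type with an enumeration V ↔ Fin n, used only to count.

card : V ↔ Fin n → Subset V → ℕ
card enum A = ∣ tabulate (A ∘ Inverse.from enum) ∣

Family : Set → Set₁
Family V = Pred (Subset V) 0ℓ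

-- Decidability expresses that K is a subset, in the classical sense, of the
-- finite set 2^V.  Closure under _⊆_ makes K respect pointwise equality.

record IsComplex (K : Family V) : Set where
  field
    member?  : Decidable K
    ∅-member : K ∅
    closed   : ∀ {A B} → A ⊆ B → K B → K A

Proper : Family V → Set
Proper K = ¬ (∀ A → K A)

CollectiveUnavoidable : (Fin r → Family V) → Set
CollectiveUnavoidable {r} {V} K =
  (A : Fin r → Subset V) → PairwiseDisjoint A → ∃[ i ] K i (A i)

record IsAlexander (enum : V ↔ Fin n) (K : Fin r → Family V) : Set where
  field
    unavoidable : CollectiveUnavoidable K
    deficient   : (A : Fin r → Subset V) → (∀ i → K i (A i)) →
                  r ∸ 1 ≤ card enum (∁ (⋃ A))

infix 9 _°

_° : Family V → Family V
(K °) F = ¬ K (∁ F)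

Skeleton : (n m : ℕ) → Family (Fin n)
Skeleton n m A = card (↔-id (Fin n)) A ≤ m

Simplex : (C : Set) → Family C
Simplex C _ = ⊤

-- Disjointness of the two vertex sets is built into V ⊎ W, in which
-- [ A , B ]′ is the characteristic function of A ∪ B.

infixr 7 _*_

_*_ : Family V → Family W → Family (V ⊎ W)
(K * L) F = ∃[ A ] ∃[ B ] K A × L B × F ≗ [ A , B ]′

-- K becomes L when vertices are relabelled along φ; the image φ(F) of a
-- subset F has characteristic function F ∘ φ⁻¹.

infix 4 _≅[_]_

_≅[_]_ : Family V → V ↔ W → Family W → Set
K ≅[ φ ] L = ∀ F → K F ⇔ L (F ∘ Inverse.from φ)

{-# OPTIONS --safe #-}
module Submission where

-- For r ≥ 3, a disjoint tuple A₁, …, Aᵣ is a colouring of V in which colour 0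
-- marks the uncovered set W and colour suc i marks the block Aᵢ.  By
-- unavoidability, every tuple of members extends to a critical one, with
-- |W| = r − 1; then no vertex of W can be added to any block.  Take a out of its
-- block Aⱼ, and w ∈ W: unavoidability applied to bijective colourings of the
-- r vertices of W ∪ {a} shows that either w can replace a in Aⱼ, or a can be
-- added to every other block.  Vertices of the second kind are "free"; the
-- others, together with W, form the "core".  As r ≥ 3, neither an exchange of a
-- core vertex with a vertex of W nor a recolouring of a free vertex changes which
-- vertices are free, and the number mᵢ of core vertices of colour i is preserved.
-- These moves bring the core vertices of Aᵢ into inclusion with those of any
-- given F, with all free vertices inside or outside Aᵢ at will, so F ∈ Kᵢ
-- exactly when F has at most mᵢ core vertices.  The free vertices span Δ(C).

open import Defs
open import Algebra.Properties.Monoid.Sum using (sum)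
open import Data.Fin using (Fin; cast)
open import Data.Fin.Patterns using (0F; 1F)
open import Data.Nat using (ℕ; _+_; _∸_; _≤_)
open import Data.Nat.Properties using (+-0-monoid)
open import Data.Product using (Σ-syntax; _×_)
open import Data.Sum using (_⊎_)
open import Function.Bundles using (_↔_)
open import Relation.Binary.PropositionalEquality using (_≡_; sym)
open import Relation.Unary using (_≐_)

import Algebra.Properties.CommutativeMonoid.Sum as CommutativeMonoidSum
open import Data.Bool using (Bool; true; false; not; _∧_; _∨_; if_then_else_; T)
open import Data.Bool.Properties using (T?; T-∧; T-∨)
open import Data.Empty using (⊥-elim)
open import Data.Fin using (zero; suc; punchOut; inject≤)
open import Data.Fin.Patterns using (2F)
open import Data.Fin.Permutation using () renaming (transpose to transposition)
open import Data.Fin.Permutation.Components using (transpose; transpose-inverse)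
open import Data.Fin.Properties
  using (_≟_; any?; all?; ¬∀⟶∃¬; punchOut-injective; punchOut-cong; inject≤-injective;
         suc-injective; 0≢1+n)
open import Data.Fin.Subset using (∣_∣)
open import Data.Nat using (zero; suc; _<_; z≤n; s≤s)
open import Data.Nat.Induction using (<-wellFounded)
open import Data.Nat.Properties as ℕ using (+-0-commutativeMonoid)
open import Data.Product using (∃-syntax; _,_; proj₁; proj₂)
open import Data.Sum using (inj₁; inj₂; [_,_]′)
open import Data.Sum.Properties using (inj₁-injective)
open import Data.Unit using (tt)
open import Data.Vec using (tabulate)
open import Data.Vec.Properties using (tabulate-cong)
open import Data.Vec.Functional using (updateAt)
open import Data.Vec.Functional.Properties using (updateAt-updates; updateAt-minimal)
open import Function using (_∘_; const; id)
open import Function.Bundles using (Inverse; Equivalence; _⇔_; mk⇔; mk↔ₛ′)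
open import Function.Construct.Composition using (_↔-∘_; _⇔-∘_)
open import Function.Construct.Identity using (↔-id)
open import Function.Definitions using (Injective)
open import Induction.WellFounded using (Acc; acc)
open import Relation.Binary.PropositionalEquality
  using (_≢_; _≗_; refl; trans; cong; cong₂; subst; module ≡-Reasoning)
open import Relation.Nullary using (¬_; Dec; yes; no; contradiction; does)
open import Relation.Nullary.Decidable
  using (⌊_⌋; toWitness; fromWitness; isYes≗does; ¬?; _×-dec_; decidable-stable; dec-true; dec-false)

private
  module ∑ = CommutativeMonoidSum +-0-commutativeMonoid

  variable
    n k : ℕ

-- Well-founded induction on `μ`: a state with `P` either has `Q` or can be improved. It replaces
-- the choice of an extremal colouring in each of the later constructions by moves.
descend : {S : Set} {P Q : S → Set} (μ : S → ℕ) →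
          (∀ s → P s → Q s ⊎ (∃[ t ] P t × μ t < μ s)) →
          ∀ s → P s → ∃[ t ] P t × Q t
descend {S} {P} {Q} μ step s = go s (<-wellFounded (μ s))
  where
  go : ∀ s → Acc _<_ (μ s) → P s → ∃[ t ] P t × Q t
  go s (acc rec) ps with step s ps
  ... | inj₁ qs              = s , ps , qs
  ... | inj₂ (t , pt , μt<μs) = go t (rec μt<μs) pt

-- Counting

indicator : Bool → ℕ
indicator b = if b then 1 else 0

size : Subset (Fin n) → ℕ
size p = ∑.sum (indicator ∘ p)

infixr 7 _∩_

_∩_ : {V : Set} → Subset V → Subset V → Subset V
(A ∩ B) x = A x ∧ B x

∈-∩ : {V : Set} (A B : Subset V) {x : V} → x ∈ A → x ∈ B → x ∈ A ∩ B
∈-∩ A B a b = Equivalence.from T-∧ (a , b)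

∈-∩⁻ : {V : Set} (A B : Subset V) {x : V} → x ∈ A ∩ B → x ∈ A × x ∈ B
∈-∩⁻ A B = Equivalence.to T-∧

indicator-mono : ∀ a b → (T a → T b) → indicator a ≤ indicator b
indicator-mono false b     _   = z≤n
indicator-mono true  true  _   = ℕ.≤-refl
indicator-mono true  false a→b = ⊥-elim (a→b tt)

indicator-strict : ∀ a b → T b → ¬ T a → indicator a < indicator b
indicator-strict false true _ _  = ℕ.≤-refl
indicator-strict true  b    _ ¬a = ⊥-elim (¬a tt)

size-mono : (p q : Subset (Fin n)) → p ⊆ q → size p ≤ size q
size-mono {zero}  p q p⊆q = z≤n
size-mono {suc n} p q p⊆q =
  ℕ.+-mono-≤ (indicator-mono (p zero) (q zero) p⊆q) (size-mono (p ∘ suc) (q ∘ suc) p⊆q)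

size-strict : (p q : Subset (Fin n)) → p ⊆ q → ∀ x → x ∈ q → ¬ x ∈ p → size p < size q
size-strict p q p⊆q zero x∈q x∉p =
  ℕ.+-mono-<-≤ (indicator-strict (p zero) (q zero) x∈q x∉p) (size-mono (p ∘ suc) (q ∘ suc) p⊆q)
size-strict p q p⊆q (suc x) x∈q x∉p =
  ℕ.+-mono-≤-< (indicator-mono (p zero) (q zero) p⊆q) (size-strict (p ∘ suc) (q ∘ suc) p⊆q x x∈q x∉p)

size-ext : (p q : Subset (Fin n)) → p ⊆ q → q ⊆ p → size p ≡ size q
size-ext p q p⊆q q⊆p = ℕ.≤-antisym (size-mono p q p⊆q) (size-mono q p q⊆p)

size-∩-mono : (p q r : Subset (Fin n)) → (∀ {x} → x ∈ p → x ∈ q → x ∈ r) → size (p ∩ q) ≤ size (p ∩ r)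
size-∩-mono p q r sub = size-mono (p ∩ q) (p ∩ r)
  (λ {x} x∈ → let (x∈p , x∈q) = ∈-∩⁻ p q {x} x∈ in ∈-∩ p r {x} x∈p (sub x∈p x∈q))

size-∩-⊇ : (p q : Subset (Fin n)) → q ⊆ p → size (p ∩ q) ≡ size q
size-∩-⊇ p q q⊆p = size-ext (p ∩ q) q
  (λ {x} → proj₂ ∘ ∈-∩⁻ p q {x}) (λ {x} x∈q → ∈-∩ p q {x} (q⊆p x∈q) x∈q)

size-transpose : (p : Subset (Fin n)) (a b : Fin n) → size (p ∘ transpose a b) ≡ size p
size-transpose p a b = sym (∑.sum-permute (indicator ∘ p) (transposition a b))

sum-ones : ∀ n → ∑.sum {n} (const 1) ≡ n
sum-ones zero    = refl
sum-ones (suc n) = cong suc (sum-ones n)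

sum-zeros : ∀ n → ∑.sum {n} (const 0) ≡ 0
sum-zeros zero    = refl
sum-zeros (suc n) = sum-zeros n

size-positive : (p : Subset (Fin n)) → 0 < size p → ∃[ x ] x ∈ p
size-positive {n} p 0<p with any? (T? ∘ p)
... | yes x  = x
... | no  ¬x = contradiction 0<p
  (ℕ.≤⇒≯ (subst (size p ≤_) (sum-zeros n) (size-mono p ∅ (λ x∈p → ¬x (_ , x∈p)))))

size-full : (p : Subset (Fin n)) → (∀ x → x ∈ p) → size p ≡ n
size-full {n} p full = trans (size-ext p (const true) (const tt) (const (full _))) (sum-ones n)

∣tabulate∣ : (p : Subset (Fin n)) → ∣ tabulate p ∣ ≡ size p
∣tabulate∣ {zero}  p = refl
∣tabulate∣ {suc n} p with p zero
... | true  = cong suc (∣tabulate∣ (p ∘ suc))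
... | false = ∣tabulate∣ (p ∘ suc)

fiber : (Fin n → Fin k) → Fin k → Subset (Fin n)
fiber f c x = ⌊ f x ≟ c ⌋

sum-indicator : ∀ b (c : Fin k) → ∑.sum (λ d → indicator (b ∧ ⌊ c ≟ d ⌋)) ≡ indicator b
sum-indicator {k} false c = sum-zeros k
sum-indicator true c  =
  trans (∑.sum-cong-≗ (λ d → cong indicator (isYes≗does (c ≟ d)))) (go c)
  where
  go : (c : Fin k) → ∑.sum (λ d → indicator (does (c ≟ d))) ≡ 1
  go (zero {n}) = cong suc (sum-zeros n)
  go (suc c)    = go c

-- Double counting: each vertex of `p` has exactly one colour, and the two sums are interchanged.
size-fibers : (p : Subset (Fin n)) (f : Fin n → Fin k) →
              size p ≡ ∑.sum (λ c → size (p ∩ fiber f c))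
size-fibers p f =
  trans (∑.sum-cong-≗ (λ x → sym (sum-indicator (p x) (f x))))
        (∑.∑-comm (λ x c → indicator (p x ∧ ⌊ f x ≟ c ⌋)))

-- With `p` the core, `split` becomes the relabelling onto `[n] ∪ C`; with `p` the uncovered set,
-- `left` lists its vertices without repetition.
record Split (p : Subset (Fin n)) : Set where
  field
    {inside outside} : ℕ
    split            : Fin n ↔ (Fin inside ⊎ Fin outside)

  left : Fin inside → Fin n
  left = Inverse.from split ∘ inj₁

  right : Fin outside → Fin n
  right = Inverse.from split ∘ inj₂

  field
    left∈     : ∀ x → left x ∈ p
    right∉    : ∀ y → ¬ right y ∈ p
    sum-split : (g : Fin n → ℕ) → ∑.sum g ≡ ∑.sum (g ∘ left) + ∑.sum (g ∘ right)

  left-injective : Injective _≡_ _≡_ left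
  left-injective {x} {y} eq = inj₁-injective (begin
    inj₁ x                       ≡⟨ Inverse.strictlyInverseˡ split (inj₁ x) ⟨
    Inverse.to split (left x)    ≡⟨ cong (Inverse.to split) eq ⟩
    Inverse.to split (left y)    ≡⟨ Inverse.strictlyInverseˡ split (inj₁ y) ⟩
    inj₁ y                       ∎)
    where open ≡-Reasoning

  left-surjective : ∀ {x} → x ∈ p → ∃[ u ] left u ≡ x
  left-surjective {x} x∈p with Inverse.to split x | Inverse.strictlyInverseʳ split x
  ... | inj₁ u | eq = u , eq
  ... | inj₂ v | refl = contradiction x∈p (right∉ v)

  size-split : (q : Subset (Fin n)) → size (p ∩ q) ≡ size (q ∘ left)
  size-split q = begin
    size (p ∩ q)
      ≡⟨ sum-split _ ⟩
    size ((p ∩ q) ∘ left) + size ((p ∩ q) ∘ right)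
      ≡⟨ cong₂ _+_ inside-only (trans outside-none (sum-zeros outside)) ⟩
    size (q ∘ left) + 0
      ≡⟨ ℕ.+-identityʳ _ ⟩
    size (q ∘ left) ∎
    where
    open ≡-Reasoning
    inside-only : size ((p ∩ q) ∘ left) ≡ size (q ∘ left)
    inside-only = size-∩-⊇ (p ∘ left) (q ∘ left) (λ {x} _ → left∈ x)
    outside-none : size ((p ∩ q) ∘ right) ≡ size {outside} ∅
    outside-none = size-ext ((p ∩ q) ∘ right) ∅
      (λ {y} → right∉ y ∘ proj₁ ∘ ∈-∩⁻ p q {right y}) ⊥-elim

  size-inside : size p ≡ inside
  size-inside = trans (sym (size-∩-⊇ p p id)) (trans (size-split p) (size-full (p ∘ left) left∈))

split-subset : (p : Subset (Fin n)) → Split p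
split-subset {zero} p = record
  { split     = mk↔ₛ′ {B = Fin 0 ⊎ Fin 0} (λ ()) [ (λ ()) , (λ ()) ]′
                  (λ { (inj₁ ()) ; (inj₂ ()) }) (λ ())
  ; left∈     = λ ()
  ; right∉    = λ ()
  ; sum-split = λ g → refl
  }
split-subset {suc n} p with split-subset (p ∘ suc) | T? (p zero)
... | S | yes 0∈p = record
  { split     = mk↔ₛ′ to from to∘from from∘to
  ; left∈     = λ { zero → 0∈p ; (suc x) → left∈ x }
  ; right∉    = right∉
  ; sum-split = λ g → trans (cong (g zero +_) (sum-split (g ∘ suc))) (sym (ℕ.+-assoc (g zero) _ _))
  }
  where
  open Split S
  to : Fin (suc n) → Fin (suc inside) ⊎ Fin outside
  to zero    = inj₁ zero
  to (suc x) = [ inj₁ ∘ suc , inj₂ ]′ (Inverse.to split x)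
  from : Fin (suc inside) ⊎ Fin outside → Fin (suc n)
  from (inj₁ zero)    = zero
  from (inj₁ (suc x)) = suc (left x)
  from (inj₂ y)       = suc (right y)
  to∘from : ∀ z → to (from z) ≡ z
  to∘from (inj₁ zero)    = refl
  to∘from (inj₁ (suc x)) rewrite Inverse.strictlyInverseˡ split (inj₁ x) = refl
  to∘from (inj₂ y)       rewrite Inverse.strictlyInverseˡ split (inj₂ y) = refl
  from∘to : ∀ x → from (to x) ≡ x
  from∘to zero = refl
  from∘to (suc x) with Inverse.to split x | Inverse.strictlyInverseʳ split x
  ... | inj₁ _ | eq = cong suc eq
  ... | inj₂ _ | eq = cong suc eq
... | S | no 0∉p = record
  { split     = mk↔ₛ′ to from to∘from from∘to
  ; left∈     = left∈
  ; right∉    = λ { zero → 0∉p ; (suc y) → right∉ y }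
  ; sum-split = λ g → trans (cong (g zero +_) (sum-split (g ∘ suc)))
                            (+-left-comm (g zero) (∑.sum (g ∘ suc ∘ left)) _)
  }
  where
  open Split S
  +-left-comm : ∀ a b c → a + (b + c) ≡ b + (a + c)
  +-left-comm a b c =
    trans (sym (ℕ.+-assoc a b c)) (trans (cong (_+ c) (ℕ.+-comm a b)) (ℕ.+-assoc b a c))
  to : Fin (suc n) → Fin inside ⊎ Fin (suc outside)
  to zero    = inj₂ zero
  to (suc x) = [ inj₁ , inj₂ ∘ suc ]′ (Inverse.to split x)
  from : Fin inside ⊎ Fin (suc outside) → Fin (suc n)
  from (inj₂ zero)    = zero
  from (inj₂ (suc x)) = suc (right x)
  from (inj₁ y)       = suc (left y)
  to∘from : ∀ z → to (from z) ≡ z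
  to∘from (inj₂ zero)    = refl
  to∘from (inj₂ (suc x)) rewrite Inverse.strictlyInverseˡ split (inj₂ x) = refl
  to∘from (inj₁ y)       rewrite Inverse.strictlyInverseˡ split (inj₁ y) = refl
  from∘to : ∀ x → from (to x) ≡ x
  from∘to zero = refl
  from∘to (suc x) with Inverse.to split x | Inverse.strictlyInverseʳ split x
  ... | inj₁ _ | eq = cong suc eq
  ... | inj₂ _ | eq = cong suc eq

-- Recolouring and exchanging

recolour : (Fin n → Fin k) → Fin n → Fin k → Fin n → Fin k
recolour f x c = updateAt f x (const c)

recolour-at : (f : Fin n → Fin k) (x : Fin n) {c : Fin k} → recolour f x c x ≡ c
recolour-at f x = updateAt-updates x f

recolour-off : (f : Fin n → Fin k) {x y : Fin n} {c : Fin k} → y ≢ x → recolour f x c y ≡ f y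
recolour-off f {x} {y} = updateAt-minimal y x f

recolour-cases : (f : Fin n → Fin k) {x y : Fin n} {c d : Fin k} → recolour f x c y ≡ d →
                 (y ≡ x × c ≡ d) ⊎ (y ≢ x × f y ≡ d)
recolour-cases f {x} {y} eq with y ≟ x
... | yes refl = inj₁ (refl , trans (sym (recolour-at f x)) eq)
... | no  y≢x  = inj₂ (y≢x , trans (sym (recolour-off f y≢x)) eq)

transpose-left : (a b : Fin n) → transpose a b a ≡ b
transpose-left a b rewrite dec-true (a ≟ a) refl = refl

transpose-right : (a b : Fin n) → transpose a b b ≡ a
transpose-right a b with b ≟ a
... | yes b≡a = b≡a
... | no  _ rewrite dec-true (b ≟ b) refl = refl

transpose-other : {a b x : Fin n} → x ≢ a → x ≢ b → transpose a b x ≡ x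
transpose-other {a = a} {b} {x} x≢a x≢b
  rewrite dec-false (x ≟ a) x≢a | dec-false (x ≟ b) x≢b = refl

transpose-injective : (a b : Fin n) → Injective _≡_ _≡_ (transpose a b)
transpose-injective a b eq =
  trans (sym (transpose-inverse b a)) (trans (cong (transpose b a) eq) (transpose-inverse b a))

transpose-∈ : (p : Subset (Fin n)) {a b : Fin n} → a ∈ p → b ∈ p →
              ∀ x → x ∈ p → transpose a b x ∈ p
transpose-∈ p {a} {b} a∈p b∈p x x∈p with does (x ≟ a)
... | true  = b∈p
... | false with does (x ≟ b)
...   | true  = a∈p
...   | false = x∈p

transpose-∈⁻ : (p : Subset (Fin n)) {a b : Fin n} → a ∈ p → b ∈ p →
               ∀ x → transpose a b x ∈ p → x ∈ p
transpose-∈⁻ p {a} {b} a∈p b∈p x tx∈p =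
  subst (_∈ p) (transpose-inverse b a) (transpose-∈ p b∈p a∈p (transpose a b x) tx∈p)

exchange : (Fin n → Fin k) → Fin n → Fin n → Fin n → Fin k
exchange f a b = f ∘ transpose a b

exchange-cases : (f : Fin n → Fin k) (a b : Fin n) {x : Fin n} {c : Fin k} → exchange f a b x ≡ c →
                 (x ≡ a × f b ≡ c) ⊎ (x ≡ b × f a ≡ c) ⊎ (x ≢ a × x ≢ b × f x ≡ c)
exchange-cases f a b {x} {c} eq = go (x ≟ a) (x ≟ b)
  where
  go : Dec (x ≡ a) → Dec (x ≡ b) → (x ≡ a × f b ≡ c) ⊎ (x ≡ b × f a ≡ c) ⊎ (x ≢ a × x ≢ b × f x ≡ c)
  go (yes refl) _          = inj₁ (refl , trans (cong f (sym (transpose-left x b))) eq)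
  go (no _)     (yes refl) = inj₂ (inj₁ (refl , trans (cong f (sym (transpose-right a x))) eq))
  go (no x≢a)   (no x≢b)   = inj₂ (inj₂ (x≢a , x≢b , trans (cong f (sym (transpose-other x≢a x≢b))) eq))

exchange-other : (f : Fin n → Fin k) {a b x : Fin n} → x ≢ a → x ≢ b → exchange f a b x ≡ f x
exchange-other f x≢a x≢b = cong f (transpose-other x≢a x≢b)

-- The two moves touch different vertices, so they commute.
exchange-recolour : (f : Fin n → Fin k) {a b x : Fin n} {c : Fin k} → x ≢ a → x ≢ b →
                    recolour (exchange f a b) x c ≗ exchange (recolour f x c) a b
exchange-recolour f {a} {b} {x} {c} x≢a x≢b y = go (y ≟ x)
  where
  go : Dec (y ≡ x) → recolour (exchange f a b) x c y ≡ exchange (recolour f x c) a b y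
  go (yes refl) = trans (recolour-at (exchange f a b) y)
                   (sym (trans (exchange-other (recolour f y _) x≢a x≢b) (recolour-at f y)))
  go (no y≢x) = trans (recolour-off (exchange f a b) y≢x)
                 (sym (recolour-off f (λ eq →
                   y≢x (transpose-injective a b (trans eq (sym (transpose-other x≢a x≢b)))))))

third : (i j : Fin (3 + n)) → ∃[ k ] k ≢ i × k ≢ j
third zero          zero          = 1F , (λ ()) , (λ ())
third zero          (suc zero)    = 2F , (λ ()) , (λ ())
third zero          (suc (suc j)) = 1F , (λ ()) , (λ ())
third (suc zero)    zero          = 2F , (λ ()) , (λ ())
third (suc (suc i)) zero          = 1F , (λ ()) , (λ ())
third (suc i)       (suc j)       = 0F , (λ ()) , (λ ())

-- Any listing of `p` can be made to show `w` at position `q` by one transposition of positions.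
-- Prescribing this position later decides which colour `w` receives.
enumerate-from : (p : Subset (Fin n)) → size p ≡ k → {w : Fin n} → w ∈ p → (q : Fin k) →
                 Σ[ e ∈ (Fin k → Fin n) ] Injective _≡_ _≡_ e × (∀ u → e u ∈ p) × e q ≡ w
enumerate-from {k = k} p refl {w} w∈p q = e , e-injective , (λ u → left∈ _) , e-q
  where
  open Split (split-subset p)
  size≤inside : k ≤ inside
  size≤inside = ℕ.≤-reflexive size-inside
  index : Fin inside
  index = proj₁ (left-surjective w∈p)
  start : Fin inside
  start = inject≤ q size≤inside
  e : Fin k → Fin _
  e u = left (transpose start index (inject≤ u size≤inside))
  e-injective : Injective _≡_ _≡_ e
  e-injective =
    inject≤-injective size≤inside size≤inside _ _ ∘ transpose-injective start index ∘ left-injective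
  e-q : e q ≡ w
  e-q = trans (cong left (transpose-left start index)) (proj₂ (left-surjective w∈p))

-- Disjoint tuples as colourings

Colouring : ℕ → ℕ → Set
Colouring s N = Fin N → Fin (4 + s)

-- Here `r` is `3 + s`: there are `4 + s` colours, as `0F` marks uncovered vertices, and `r − 1` is
-- `2 + s`. A colouring makes the blocks disjoint by construction.
module AlexanderTuple
  (s N : ℕ) (K : Fin (3 + s) → Family (Fin N)) (complex : ∀ i → IsComplex (K i))
  (unavoidable : (f : Colouring s N) → ∃[ i ] K i (fiber f (suc i)))
  (deficient : (f : Colouring s N) → (∀ i → K i (fiber f (suc i))) → 2 + s ≤ size (fiber f 0F))
  where

  private
    variable
      f g : Colouring s N
      i j   : Fin (3 + s)
      a b c w x y : Fin N

  -- Admissible and critical colourings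

  BlockIn : Colouring s N → Fin (3 + s) → Set
  BlockIn f i = K i (fiber f (suc i))

  Admissible : Colouring s N → Set
  Admissible f = ∀ i → BlockIn f i

  -- Only block `i` is tested: the condition is that `Aᵢ ∪ {x}` lies in `Kᵢ`, wherever `x` is at
  -- present.
  Addable : Colouring s N → Fin N → Fin (3 + s) → Set
  Addable f x i = BlockIn (recolour f x (suc i)) i

  Free : Colouring s N → Fin N → Set
  Free f x = ∀ i → Addable f x i

  record Critical (f : Colouring s N) : Set where
    constructor critical
    field
      admissible : Admissible f
      uncovered  : size (fiber f 0F) ≡ 2 + s

  open Critical

  -- Closure under subsets, read on colour classes. Most membership claims below reduce to such an
  -- inclusion, called `sub`.
  block-antitone : (∀ x → g x ≡ suc i → f x ≡ suc i) → BlockIn f i → BlockIn g i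
  block-antitone {i = i} g⊆f = IsComplex.closed (complex i) (λ p → fromWitness (g⊆f _ (toWitness p)))

  abstract
    free? : ∀ f x → Dec (Free f x)
    free? f x = all? (λ i → IsComplex.member? (complex i) (fiber (recolour f x (suc i)) (suc i)))

  -- Blocks other than `i` can at most lose `x`.
  recolour-admissible : Admissible f → Addable f x i → Admissible (recolour f x (suc i))
  recolour-admissible {f} {x} {i} adm add k with i ≟ k
  ... | yes refl = add
  ... | no  i≢k  = block-antitone sub (adm k)
    where
    sub : ∀ y → recolour f x (suc i) y ≡ suc k → f y ≡ suc k
    sub y eq with recolour-cases f eq
    ... | inj₁ (_ , i≡k)  = contradiction (suc-injective i≡k) i≢k
    ... | inj₂ (_ , fy≡k) = fy≡k

  addable-own : Admissible f → f x ≡ suc i → Addable f x i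
  addable-own {f} {x} {i} adm fx≡i = block-antitone sub (adm i)
    where
    sub : ∀ y → recolour f x (suc i) y ≡ suc i → f y ≡ suc i
    sub y eq with recolour-cases f eq
    ... | inj₁ (refl , _) = fx≡i
    ... | inj₂ (_ , fy≡i) = fy≡i

  recolour-strict : f x ≡ 0F → size (fiber (recolour f x (suc i)) 0F) < size (fiber f 0F)
  recolour-strict {f} {x} {i} fx≡0 =
    size-strict (fiber (recolour f x (suc i)) 0F) (fiber f 0F) (λ p → fromWitness (sub _ (toWitness p)))
      x (fromWitness fx≡0) (λ p → 0≢1+n (trans (sym (toWitness p)) (recolour-at f x)))
    where
    sub : ∀ y → recolour f x (suc i) y ≡ 0F → f y ≡ 0F
    sub y eq with recolour-cases f eq
    ... | inj₁ (_ , ())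
    ... | inj₂ (_ , fy≡0) = fy≡0

  -- Adding `w` would give a tuple of members with fewer than `r − 1` uncovered vertices, against
  -- deficiency.
  saturated : Critical f → f w ≡ 0F → ¬ Addable f w i
  saturated {f} {w} {i} crit fw≡0 add =
    ℕ.<⇒≱ (recolour-strict {f} {w} {i} fw≡0)
      (subst (_≤ size (fiber (recolour f w (suc i)) 0F)) (sym (uncovered crit))
        (deficient _ (recolour-admissible (admissible crit) add)))

  uncovered-vertex : Critical f → ∃[ w ] f w ≡ 0F
  uncovered-vertex {f} crit with size-positive (fiber f 0F) (subst (0 <_) (sym (uncovered crit)) (s≤s z≤n))
  ... | w , w∈ = w , toWitness w∈

  -- Give all the vertices `ι i` their colours `suc i` at once. Block `i` then gains `ι i` and
  -- nothing else, and unavoidability names a block that is a member.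
  some-addable : (f : Colouring s N) (ι : Fin (3 + s) → Fin N) → Injective _≡_ _≡_ ι →
                 (∀ i → f (ι i) ≡ 0F) → ∃[ i ] Addable f (ι i) i
  some-addable f ι ι-injective ι-uncovered =
    let (i , ∈Kᵢ) = unavoidable spread in i , block-antitone (sub i) ∈Kᵢ
    where
    spread : Colouring s N
    spread y with any? (λ i → ι i ≟ y)
    ... | yes (i , _) = suc i
    ... | no _        = f y
    sub : ∀ i y → recolour f (ι i) (suc i) y ≡ suc i → spread y ≡ suc i
    sub i y eq with any? (λ j → ι j ≟ y) | recolour-cases f eq
    ... | yes (j , ιj≡y) | inj₁ (y≡ιi , _) = cong suc (ι-injective (trans ιj≡y y≡ιi))
    ... | yes (j , refl) | inj₂ (_ , fy≡i) = contradiction (trans (sym (ι-uncovered j)) fy≡i) 0≢1+n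
    ... | no ∄           | inj₁ (y≡ιi , _) = contradiction (i , sym y≡ιi) ∄
    ... | no _           | inj₂ (_ , fy≡i) = fy≡i

  abstract
    -- Start with empty blocks. While at least `r` vertices are uncovered, `some-addable` lets one
    -- of them be added; deficiency stops the process at exactly `r − 1`.
    critical-exists : ∃[ f ] Critical f
    critical-exists =
      let (f , adm , eq) = descend {P = Admissible} (λ f → size (fiber f 0F)) step (const 0F) ∅-admissible
      in f , critical adm eq
      where
      ∅-admissible : Admissible (const 0F)
      ∅-admissible i = IsComplex.closed (complex i) (λ ()) (IsComplex.∅-member (complex i))

      grow : ∀ f → Admissible f → 3 + s ≤ size (fiber f 0F) →
             ∃[ g ] Admissible g × size (fiber g 0F) < size (fiber f 0F)
      grow f adm large =
        let (i , add) = some-addable f ι ι-injective ι-uncovered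
        in recolour f (ι i) (suc i) , recolour-admissible adm add , recolour-strict (ι-uncovered i)
        where
        open Split (split-subset (fiber f 0F))
        large′ : 3 + s ≤ inside
        large′ = subst (3 + s ≤_) size-inside large
        ι : Fin (3 + s) → Fin N
        ι i = left (inject≤ i large′)
        ι-injective : Injective _≡_ _≡_ ι
        ι-injective = inject≤-injective large′ large′ _ _ ∘ left-injective
        ι-uncovered : ∀ i → f (ι i) ≡ 0F
        ι-uncovered i = toWitness (left∈ (inject≤ i large′))

      step : ∀ f → Admissible f → size (fiber f 0F) ≡ 2 + s ⊎
             (∃[ g ] Admissible g × size (fiber g 0F) < size (fiber f 0F))
      step f adm with ℕ.m≤n⇒m<n∨m≡n (deficient f adm)
      ... | inj₁ large = inj₂ (grow f adm large)
      ... | inj₂ eq    = inj₁ (sym eq)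

  -- Exchanges with an uncovered vertex

  critical-resp : f ≗ g → Critical f → Critical g
  critical-resp {f} {g} f≗g crit = critical
    (λ i → block-antitone (λ x → trans (f≗g x)) (admissible crit i))
    (trans (size-ext (fiber g 0F) (fiber f 0F)
              (λ p → fromWitness (trans (f≗g _) (toWitness p)))
              (λ p → fromWitness (trans (sym (f≗g _)) (toWitness p))))
           (uncovered crit))

  recolour-resp : f ≗ g → ∀ x {c} → recolour f x c ≗ recolour g x c
  recolour-resp {f} {g} f≗g x y with y ≟ x
  ... | yes refl = trans (recolour-at f x) (sym (recolour-at g x))
  ... | no  y≢x  = trans (recolour-off f y≢x) (trans (f≗g y) (sym (recolour-off g y≢x)))

  free-resp : f ≗ g → Free f x → Free g x
  free-resp {x = x} f≗g free i = block-antitone (λ y → trans (recolour-resp f≗g x y)) (free i)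

  -- A transposition keeps the number of uncovered vertices, and only the block of `a` receives a
  -- new vertex; if `a` is uncovered there is nothing to check.
  exchange-critical′ : Critical f → f w ≡ 0F → (∀ j → f a ≡ suc j → BlockIn (exchange f a w) j) →
                       Critical (exchange f a w)
  exchange-critical′ {f} {w} {a} crit fw≡0 new =
    critical block (trans (size-transpose (fiber f 0F) a w) (uncovered crit))
    where
    block : ∀ k → BlockIn (exchange f a w) k
    block k with f a ≟ suc k
    ... | yes fa≡k = new k fa≡k
    ... | no  fa≢k = block-antitone sub (admissible crit k)
      where
      sub : ∀ y → exchange f a w y ≡ suc k → f y ≡ suc k
      sub y eq with exchange-cases f a w eq
      ... | inj₁ (_ , fw≡k)             = contradiction (trans (sym fw≡0) fw≡k) 0≢1+n
      ... | inj₂ (inj₁ (_ , fa≡k))      = contradiction fa≡k fa≢k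
      ... | inj₂ (inj₂ (_ , _ , fy≡k))  = fy≡k

  -- Uncolour a and colour the r vertices of W ∪ {a} bijectively, so that a
  -- gets colour i and w gets colour j; only those two additions can succeed.
  addable-or-exchange : Critical f → f a ≡ suc j → f w ≡ 0F → i ≢ j →
                        Addable f a i ⊎ BlockIn (exchange f a w) j
  addable-or-exchange {f} {a} {j} {w} {i} crit fa≡j fw≡0 i≢j =
    -- The colours other than `i`, numbered by `punchOut`, index the uncovered vertices; the
    -- position of `j` is reserved for `w`.
    from-enumeration (enumerate-from (fiber f 0F) (uncovered crit) (fromWitness fw≡0) (punchOut i≢j))
    where
    f′ : Colouring s N
    f′ = recolour f a 0F

    fw≢j : f w ≢ suc j
    fw≢j eq = 0≢1+n (trans (sym fw≡0) eq)

    from-enumeration : (Σ[ e ∈ (Fin (2 + s) → Fin N) ] Injective _≡_ _≡_ e ×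
                         (∀ u → e u ∈ fiber f 0F) × e (punchOut i≢j) ≡ w) →
                       Addable f a i ⊎ BlockIn (exchange f a w) j
    from-enumeration (e , e-injective , e∈W , e-punchOut) = conclude (some-addable f′ ι ι-injective ι-uncovered)
      where
      e-uncovered : ∀ q → f (e q) ≡ 0F
      e-uncovered q = toWitness (e∈W q)

      e≢a : ∀ q → e q ≢ a
      e≢a q eq = 0≢1+n (trans (sym (e-uncovered q)) (trans (cong f eq) fa≡j))

      ι : Fin (3 + s) → Fin N
      ι k with i ≟ k
      ... | yes _   = a
      ... | no  i≢k = e (punchOut i≢k)

      ι-injective : Injective _≡_ _≡_ ι
      ι-injective {k} {l} eq with i ≟ k | i ≟ l
      ... | yes refl | yes refl = refl
      ... | yes _    | no i≢l   = contradiction (sym eq) (e≢a (punchOut i≢l))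
      ... | no i≢k   | yes _    = contradiction eq (e≢a (punchOut i≢k))
      ... | no i≢k   | no i≢l   = punchOut-injective i≢k i≢l (e-injective eq)

      ι-uncovered : ∀ k → f′ (ι k) ≡ 0F
      ι-uncovered k with i ≟ k
      ... | yes _   = recolour-at f a
      ... | no  i≢k = trans (recolour-off f (e≢a (punchOut i≢k))) (e-uncovered (punchOut i≢k))

      conclude : ∃[ k ] Addable f′ (ι k) k → Addable f a i ⊎ BlockIn (exchange f a w) j
      conclude (k , add) with i ≟ k
      ... | yes refl = inj₁ (block-antitone sub add)
        where
        sub : ∀ y → recolour f a (suc i) y ≡ suc i → recolour f′ a (suc i) y ≡ suc i
        sub y eq with recolour-cases f eq
        ... | inj₁ (refl , _)   = recolour-at f′ a
        ... | inj₂ (y≢a , fy≡i) = trans (recolour-off f′ y≢a) (trans (recolour-off f y≢a) fy≡i)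
      ... | no i≢k with j ≟ k
      ...   | yes refl = inj₂ (block-antitone sub add)
        where
        v : Fin N
        v = e (punchOut i≢k)
        v≡w : v ≡ w
        v≡w = trans (cong e (punchOut-cong i refl)) e-punchOut
        sub : ∀ y → exchange f a w y ≡ suc j → recolour f′ v (suc j) y ≡ suc j
        sub y eq with exchange-cases f a w eq
        ... | inj₁ (_ , fw≡j)                = contradiction fw≡j fw≢j
        ... | inj₂ (inj₁ (y≡w , _))          =
          trans (cong (recolour f′ v (suc j)) (trans y≡w (sym v≡w))) (recolour-at f′ v)
        ... | inj₂ (inj₂ (y≢a , y≢w , fy≡j)) =
          trans (recolour-off f′ (λ y≡v → y≢w (trans y≡v v≡w))) (trans (recolour-off f y≢a) fy≡j)
      -- Uncolouring `a` changed only block `j`, so success in another block `k` would already be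
      -- possible in `f`, against saturation.
      ...   | no j≢k = contradiction (block-antitone sub add) (saturated crit (e-uncovered (punchOut i≢k)))
        where
        v : Fin N
        v = e (punchOut i≢k)
        sub : ∀ y → recolour f v (suc k) y ≡ suc k → recolour f′ v (suc k) y ≡ suc k
        sub y eq with recolour-cases f eq
        ... | inj₁ (refl , _)   = recolour-at f′ v
        ... | inj₂ (y≢v , fy≡k) = trans (recolour-off f′ y≢v) (trans (recolour-off f y≢a) fy≡k)
          where
          y≢a : y ≢ a
          y≢a refl = j≢k (suc-injective (trans (sym fa≡j) fy≡k))

  -- Some block refuses `a`, and it is not the block of `a` itself; the dichotomy for that colour
  -- leaves only the exchange.
  exchange-critical : Critical f → f w ≡ 0F → ¬ Free f a → Critical (exchange f a w)
  exchange-critical {f} {w} {a} crit fw≡0 ¬free = exchange-critical′ crit fw≡0 new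
    where
    new : ∀ j → f a ≡ suc j → BlockIn (exchange f a w) j
    new j fa≡j with ¬∀⟶∃¬ _ (Addable f a) (λ i → IsComplex.member? (complex i) _) ¬free
    ... | i , ¬add with addable-or-exchange crit fa≡j fw≡0
                          (λ { refl → ¬add (addable-own (admissible crit) fa≡j) })
    ...   | inj₁ add = contradiction add ¬add
    ...   | inj₂ new = new

  -- The exchange leaves `a` uncovered and removes no vertex but possibly `w` from consideration: as
  -- `Aᵢ` contains neither `a` nor `w`, it is unchanged, and saturation after the exchange forbids
  -- `a`.
  exchange⇒¬addable : Critical f → f w ≡ 0F → f a ≢ suc i → Critical (exchange f a w) → ¬ Addable f a i
  exchange⇒¬addable {f} {w} {a} {i} crit fw≡0 fa≢i crit′ add =
    saturated crit′ (trans (cong f (transpose-left a w)) fw≡0) (block-antitone sub add)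
    where
    sub : ∀ y → recolour (exchange f a w) a (suc i) y ≡ suc i → recolour f a (suc i) y ≡ suc i
    sub y eq with recolour-cases (exchange f a w) eq
    ... | inj₁ (refl , _) = recolour-at f a
    ... | inj₂ (y≢a , eq′) with exchange-cases f a w eq′
    ...   | inj₁ (y≡a , _)            = contradiction y≡a y≢a
    ...   | inj₂ (inj₁ (_ , fa≡i))     = contradiction fa≡i fa≢i
    ...   | inj₂ (inj₂ (_ , _ , fy≡i)) = trans (recolour-off f y≢a) fy≡i

  -- Free vertices and their stability under both moves

  third-colour : (d : Fin (4 + s)) (i : Fin (3 + s)) → ∃[ k ] d ≢ suc k × k ≢ i
  third-colour zero    i with third i i
  ... | k , k≢i , _ = k , (λ ()) , k≢i
  third-colour (suc j) i with third i j
  ... | k , k≢i , k≢j = k , (λ eq → k≢j (sym (suc-injective eq))) , k≢i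

  -- Converse of `exchange-critical`: being exchangeable with an uncovered vertex characterises the
  -- vertices that are not free.
  exchange⇒¬free : Critical f → f w ≡ 0F → Critical (exchange f a w) → ¬ Free f a
  exchange⇒¬free {f} {a = a} crit fw≡0 crit′ free with third-colour (f a) 0F
  ... | k , fa≢k , _ = exchange⇒¬addable crit fw≡0 fa≢k crit′ (free k)

  -- One foreign block suffices: if `c` were not free, it could be exchanged with an uncovered
  -- vertex, and then no foreign block would accept it.
  addable⇒free : Critical f → f c ≢ suc i → Addable f c i → Free f c
  addable⇒free {f} {c} crit fc≢i add with free? f c | uncovered-vertex crit
  ... | yes free | _          = free
  ... | no ¬free | w , fw≡0 =
    contradiction add (exchange⇒¬addable crit fw≡0 fc≢i (exchange-critical crit fw≡0 ¬free))

  free-coloured : Critical f → Free f c → ∃[ i ] f c ≡ suc i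
  free-coloured {f} {c} crit free with f c in eq
  ... | zero  = contradiction (free 0F) (saturated crit eq)
  ... | suc i = i , refl

  -- Only here is r ≥ 3 essential: the block of a colour that neither c nor a
  -- has is untouched by the exchange, so it still accepts c.
  exchange-free : Critical f → f w ≡ 0F → ¬ Free f a → Free f c → Free (exchange f a w) c
  exchange-free {f} {w} {a} {c} crit fw≡0 ¬freeₐ free with free-coloured crit free
  ... | i , fc≡i with third-colour (f a) i
  ... | k , fa≢k , k≢i = addable⇒free (exchange-critical crit fw≡0 ¬freeₐ) c≢k (block-antitone sub (free k))
    where
    c≢a : c ≢ a
    c≢a refl = ¬freeₐ free
    c≢w : c ≢ w
    c≢w refl = 0≢1+n (trans (sym fw≡0) fc≡i)
    c≢k : exchange f a w c ≢ suc k
    c≢k eq = k≢i (sym (suc-injective (trans (sym fc≡i) (trans (sym (exchange-other f c≢a c≢w)) eq))))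
    sub : ∀ y → recolour (exchange f a w) c (suc k) y ≡ suc k → recolour f c (suc k) y ≡ suc k
    sub y eq with recolour-cases (exchange f a w) eq
    ... | inj₁ (refl , _) = recolour-at f y
    ... | inj₂ (y≢c , eq′) with exchange-cases f a w eq′
    ...   | inj₁ (_ , fw≡k)            = contradiction (trans (sym fw≡0) fw≡k) 0≢1+n
    ...   | inj₂ (inj₁ (_ , fa≡k))     = contradiction fa≡k fa≢k
    ...   | inj₂ (inj₂ (_ , _ , fy≡k)) = trans (recolour-off f y≢c) fy≡k

  -- Exchanges are reversible: afterwards `a` is uncovered and `w` is not free, so exchanging back
  -- carries a free `b` to a free `b` in `f`.
  exchange-rigid : Critical f → f w ≡ 0F → ¬ Free f a → ¬ Free f b → ¬ Free (exchange f a w) b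
  exchange-rigid {f} {w} {a} {b} crit fw≡0 ¬freeₐ ¬freeᵦ free =
    ¬freeᵦ (free-resp back (exchange-free crit′ ga≡0 ¬free-w free))
    where
    crit′ : Critical (exchange f a w)
    crit′ = exchange-critical crit fw≡0 ¬freeₐ
    ga≡0 : exchange f a w a ≡ 0F
    ga≡0 = trans (cong f (transpose-left a w)) fw≡0
    back : exchange (exchange f a w) w a ≗ f
    back x = cong f (transpose-inverse a w)
    ¬free-w : ¬ Free (exchange f a w) w
    ¬free-w = exchange⇒¬free crit′ ga≡0 (critical-resp (sym ∘ back) crit)

  -- By saturation a free vertex is never uncovered, so the uncovered set stays the same.
  recolour-critical : Critical f → Free f c → Critical (recolour f c (suc i))
  recolour-critical {f} {c} {i} crit free = critical
    (recolour-admissible (admissible crit) (free i))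
    (trans (size-ext (fiber (recolour f c (suc i)) 0F) (fiber f 0F)
              (λ p → fromWitness (to (toWitness p))) (λ p → fromWitness (from (toWitness p))))
           (uncovered crit))
    where
    to : recolour f c (suc i) x ≡ 0F → f x ≡ 0F
    to eq with recolour-cases f eq
    ... | inj₁ (_ , ())
    ... | inj₂ (_ , fx≡0) = fx≡0
    from : f x ≡ 0F → recolour f c (suc i) x ≡ 0F
    from {x} fx≡0 = trans (recolour-off f x≢c) fx≡0
      where
      x≢c : x ≢ c
      x≢c refl = saturated crit fx≡0 (free 0F)

  -- Exchanging `a` with `w` keeps `c` free, so recolouring `c` afterwards is critical. The moves
  -- commute, hence `a` is exchangeable after the recolouring too.
  recolour-rigid : Critical f → Free f c → ¬ Free f a → ¬ Free (recolour f c (suc i)) a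
  recolour-rigid {f} {c} {a} {i} crit free ¬freeₐ with uncovered-vertex crit | free-coloured crit free
  ... | w , fw≡0 | k , fc≡k =
    exchange⇒¬free (recolour-critical crit free) (trans (recolour-off f (c≢w ∘ sym)) fw≡0)
      (critical-resp (exchange-recolour f c≢a c≢w)
        (recolour-critical (exchange-critical crit fw≡0 ¬freeₐ) (exchange-free crit fw≡0 ¬freeₐ free)))
    where
    c≢a : c ≢ a
    c≢a refl = ¬freeₐ free
    c≢w : c ≢ w
    c≢w refl = 0≢1+n (trans (sym fw≡0) fc≡k)

  -- Giving `c` its old colour back restores `f`, and by `recolour-rigid` this would keep `x` from
  -- being free.
  recolour-free : Critical f → Free f c → Free f x → Free (recolour f c (suc i)) x
  recolour-free {f} {c} {x} {i} crit free-c free-x with free? (recolour f c (suc i)) x | free-coloured crit free-c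
  ... | yes free | _ = free
  ... | no ¬free | k , fc≡k =
    contradiction (free-resp (sym ∘ back) free-x)
      (recolour-rigid (recolour-critical crit free-c) free-c′ ¬free)
    where
    twice : ∀ d y → recolour (recolour f c (suc i)) c d y ≡ recolour f c d y
    twice d y with y ≟ c
    ... | yes refl = trans (recolour-at (recolour f c (suc i)) c) (sym (recolour-at f c))
    ... | no  y≢c  = trans (recolour-off (recolour f c (suc i)) y≢c)
                       (trans (recolour-off f y≢c) (sym (recolour-off f y≢c)))
    free-c′ : Free (recolour f c (suc i)) c
    free-c′ l = block-antitone (λ y eq → trans (sym (twice (suc l) y)) eq) (free-c l)
    back : recolour (recolour f c (suc i)) c (suc k) ≗ f
    back y with y ≟ c
    ... | yes refl = trans (recolour-at (recolour f c (suc i)) c) (sym fc≡k)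
    ... | no  y≢c  = trans (recolour-off (recolour f c (suc i)) y≢c) (recolour-off f y≢c)

  -- The core and the invariants of the moves

  f₀ : Colouring s N
  f₀ = proj₁ critical-exists

  core : Subset (Fin N)
  core x = ⌊ ¬? (free? f₀ x) ⌋

  m : Fin (3 + s) → ℕ
  m i = size (core ∩ fiber f₀ (suc i))

  -- What both moves preserve, measured against the fixed reference `f₀`: criticality, the set of
  -- free vertices, and the number of core vertices in each block.
  record Similar (f : Colouring s N) : Set where
    field
      crit  : Critical f
      free  : ¬ x ∈ core → Free f x
      rigid : x ∈ core → ¬ Free f x
      sizes : ∀ i → size (core ∩ fiber f (suc i)) ≡ m i

  f₀-similar : Similar f₀
  f₀-similar = record
    { crit  = proj₂ critical-exists
    ; free  = λ x∉core → decidable-stable (free? f₀ _) (λ ¬free → x∉core (fromWitness ¬free))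
    ; rigid = toWitness
    ; sizes = λ i → refl
    }

  exchange-similar : Similar f → f w ≡ 0F → a ∈ core → Similar (exchange f a w)
  exchange-similar {f} {w} {a} sim fw≡0 a∈ = record
    { crit  = exchange-critical crit fw≡0 (rigid a∈)
    ; free  = λ x∉ → exchange-free crit fw≡0 (rigid a∈) (free x∉)
    ; rigid = λ x∈ → exchange-rigid crit fw≡0 (rigid a∈) (rigid x∈)
    ; sizes = λ i → trans (core-fiber i) (sizes i)
    }
    where
    open Similar sim
    -- Outside the core `w` would be free in `f`, against saturation. With `a` and `w` both in the
    -- core, the transposition preserves the core and hence the counts.
    w∈ : w ∈ core
    w∈ = fromWitness (λ free₀ → saturated crit fw≡0 (decidable-stable (free? f w)
      (λ ¬free → ¬free (free (λ w∈ → toWitness w∈ free₀))) 0F))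
    core-fiber : ∀ i → size (core ∩ fiber (exchange f a w) (suc i)) ≡ size (core ∩ fiber f (suc i))
    core-fiber i = trans (size-ext (core ∩ fᵢ ∘ transpose a w) ((core ∩ fᵢ) ∘ transpose a w)
                           (λ {x} p → let (q , r) = ∈-∩⁻ core (fᵢ ∘ transpose a w) {x} p in
                             ∈-∩ core fᵢ {transpose a w x} (transpose-∈ core a∈ w∈ x q) r)
                           (λ {x} p → let (q , r) = ∈-∩⁻ core fᵢ {transpose a w x} p in
                             ∈-∩ core (fᵢ ∘ transpose a w) {x} (transpose-∈⁻ core a∈ w∈ x q) r))
                         (size-transpose (core ∩ fᵢ) a w)
      where
      fᵢ : Subset (Fin N)
      fᵢ = fiber f (suc i)

  recolour-similar : Similar f → ¬ c ∈ core → ∀ k → Similar (recolour f c (suc k))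
  recolour-similar {f} {c} sim c∉ k = record
    { crit  = recolour-critical crit (free c∉)
    ; free  = λ x∉ → recolour-free crit (free c∉) (free x∉)
    ; rigid = λ x∈ → recolour-rigid crit (free c∉) (rigid x∈)
    ; sizes = λ i → trans (ℕ.≤-antisym
        (size-∩-mono core (fiber f₁ (suc i)) (fiber f (suc i))
          (λ x∈ p → fromWitness (trans (sym (off x∈)) (toWitness p))))
        (size-∩-mono core (fiber f (suc i)) (fiber f₁ (suc i))
          (λ x∈ p → fromWitness (trans (off x∈) (toWitness p)))))
        (sizes i)
    }
    where
    open Similar sim
    f₁ : Colouring s N
    f₁ = recolour f c (suc k)
    off : x ∈ core → f₁ x ≡ f x
    off x∈ = recolour-off f (λ { refl → c∉ x∈ })

  -- Aligning a block with a given set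

  Flooded : Fin (3 + s) → Colouring s N → Set
  Flooded k f = ∀ {x} → ¬ x ∈ core → f x ≡ suc k

  -- Free vertices are recoloured one by one. The choice `k = i` will put them all into block `i`,
  -- any other `k` keeps them all out.
  flood : ∀ k → ∃[ f ] Similar f × Flooded k f
  flood k = descend μ step f₀ f₀-similar
    where
    bad? : ∀ f x → Dec (¬ x ∈ core × f x ≢ suc k)
    bad? f x = ¬? (T? (core x)) ×-dec ¬? (f x ≟ suc k)
    μ : Colouring s N → ℕ
    μ f = size (λ x → ⌊ bad? f x ⌋)
    step : ∀ f → Similar f → Flooded k f ⊎ (∃[ f₁ ] Similar f₁ × μ f₁ < μ f)
    step f sim with any? (bad? f)
    ... | no ∄ = inj₁ (λ {x} x∉ → decidable-stable (f x ≟ suc k) (λ fx≢k → ∄ (x , x∉ , fx≢k)))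
    ... | yes (c , c∉ , fc≢k) = inj₂ (f₁ , recolour-similar sim c∉ k ,
        size-strict (λ x → ⌊ bad? f₁ x ⌋) (λ x → ⌊ bad? f x ⌋)
          (λ {x} p → fromWitness (sub x (toWitness p)))
          c (fromWitness (c∉ , fc≢k)) (λ p → proj₂ (toWitness p) (recolour-at f c)))
      where
      f₁ : Colouring s N
      f₁ = recolour f c (suc k)
      sub : ∀ x → ¬ x ∈ core × f₁ x ≢ suc k → ¬ x ∈ core × f x ≢ suc k
      sub x (x∉ , gx≢k) with x ≟ c
      ... | yes refl = x∉ , fc≢k
      ... | no  x≢c  = x∉ , λ fx≡k → gx≢k (trans (recolour-off f x≢c) fx≡k)

  exchange-flooded : ∀ {k} → Flooded k f → f w ≡ 0F → a ∈ core → Flooded k (exchange f a w)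
  exchange-flooded {f} flooded fw≡0 a∈ x∉ =
    trans (exchange-other f (λ { refl → x∉ a∈ }) (λ { refl → 0≢1+n (trans (sym fw≡0) (flooded x∉)) }))
          (flooded x∉)

  -- Exchange `x` with an uncovered vertex; neither has colour `suc i`, so block `i` is untouched.
  uncolour : ∀ {k} → Similar f → Flooded k f → x ∈ core → f x ≢ suc i →
             ∃[ g ] (Similar g × Flooded k g) × g x ≡ 0F × (∀ y → g y ≡ suc i ⇔ f y ≡ suc i)
  uncolour {f} {x} {i} sim flooded x∈ fx≢i with uncovered-vertex (Similar.crit sim)
  ... | w , fw≡0 = f₁ , (exchange-similar sim fw≡0 x∈ , exchange-flooded flooded fw≡0 x∈) ,
                   trans (cong f (transpose-left x w)) fw≡0 , λ y → mk⇔ (to y) (from y)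
    where
    f₁ : Colouring s N
    f₁ = exchange f x w
    to : ∀ y → f₁ y ≡ suc i → f y ≡ suc i
    to y eq with exchange-cases f x w eq
    ... | inj₁ (_ , fw≡i)            = contradiction (trans (sym fw≡0) fw≡i) 0≢1+n
    ... | inj₂ (inj₁ (_ , fx≡i))     = contradiction fx≡i fx≢i
    ... | inj₂ (inj₂ (_ , _ , fy≡i)) = fy≡i
    from : ∀ y → f y ≡ suc i → f₁ y ≡ suc i
    from y fy≡i = trans (exchange-other f (λ { refl → fx≢i fy≡i })
                                          (λ { refl → 0≢1+n (trans (sym fw≡0) fy≡i) })) fy≡i

  -- Within the core, either `F` lies in `Aᵢ` or `Aᵢ` lies in `F`; the second case carries a vertex
  -- making the inclusion strict.
  Comparable : Subset (Fin N) → Fin (3 + s) → Colouring s N → Set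
  Comparable F i f =
    (∀ {x} → x ∈ core → x ∈ F → f x ≡ suc i) ⊎
    ((∃[ x ] x ∈ core × x ∈ F × f x ≢ suc i) × (∀ {y} → y ∈ core → f y ≡ suc i → y ∈ F))

  -- If the core has `x` in `F` outside `Aᵢ` and `y` in `Aᵢ` outside `F`, uncover `x` without
  -- touching `Aᵢ` and exchange `y` with it. This lowers the number of core vertices of `F` missing
  -- from `Aᵢ`.
  align : ∀ F i k → ∃[ f ] (Similar f × Flooded k f) × Comparable F i f
  align F i k = descend μ step (proj₁ (flood k)) (proj₂ (flood k))
    where
    missing? : ∀ f x → Dec (x ∈ core × x ∈ F × f x ≢ suc i)
    missing? f x = T? (core x) ×-dec T? (F x) ×-dec ¬? (f x ≟ suc i)
    extra? : ∀ f y → Dec (y ∈ core × f y ≡ suc i × ¬ y ∈ F)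
    extra? f y = T? (core y) ×-dec (f y ≟ suc i) ×-dec ¬? (T? (F y))
    μ : Colouring s N → ℕ
    μ f = size (λ x → ⌊ missing? f x ⌋)
    step : ∀ f → Similar f × Flooded k f →
           Comparable F i f ⊎ (∃[ g ] (Similar g × Flooded k g) × μ g < μ f)
    step f (sim , flooded) with any? (missing? f) | any? (extra? f)
    ... | no ∄  | _ = inj₁ (inj₁ (λ {x} x∈ x∈F →
      decidable-stable (f x ≟ suc i) (λ fx≢i → ∄ (x , x∈ , x∈F , fx≢i))))
    ... | yes x | no ∄ = inj₁ (inj₂ (x , λ {y} y∈ fy≡i →
      decidable-stable (T? (F y)) (λ y∉F → ∄ (y , y∈ , fy≡i , y∉F))))
    ... | yes (x , x∈ , x∈F , fx≢i) | yes (y , y∈ , fy≡i , y∉F) with uncolour sim flooded x∈ fx≢i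
    ...   | f₁ , (sim′ , flooded′) , gx≡0 , same = inj₂ (f₂ ,
        (exchange-similar sim′ gx≡0 y∈ , exchange-flooded flooded′ gx≡0 y∈) ,
        size-strict (λ z → ⌊ missing? f₂ z ⌋) (λ z → ⌊ missing? f z ⌋)
          (λ {z} p → fromWitness (sub z (toWitness p)))
          x (fromWitness (x∈ , x∈F , fx≢i)) (λ p → proj₂ (proj₂ (toWitness p)) hx≡i))
      where
      f₂ : Colouring s N
      f₂ = exchange f₁ y x
      hx≡i : f₂ x ≡ suc i
      hx≡i = trans (cong f₁ (transpose-right y x)) (Equivalence.from (same y) fy≡i)
      sub : ∀ z → z ∈ core × z ∈ F × f₂ z ≢ suc i → z ∈ core × z ∈ F × f z ≢ suc i
      sub z (z∈ , z∈F , hz≢i) = z∈ , z∈F , λ fz≡i →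
        hz≢i (trans (exchange-other f₁ (λ { refl → y∉F z∈F }) (λ { refl → fx≢i fz≡i }))
                    (Equivalence.from (same z) fz≡i))

  -- Flooding with `i` itself puts every free vertex into `Aᵢ`. Strict inclusion of the core part of
  -- `Aᵢ` in `F` would exceed the count, so `F` lies in `Aᵢ`.
  small⇒member : ∀ i F → size (core ∩ F) ≤ m i → K i F
  small⇒member i F small with align F i i
  ... | f , (sim , flooded) , cmp =
    IsComplex.closed (complex i) (λ {x} x∈F → fromWitness (F⊆ x x∈F)) (admissible (Similar.crit sim) i)
    where
    core-F⊆ : Comparable F i f → ∀ {x} → x ∈ core → x ∈ F → f x ≡ suc i
    core-F⊆ (inj₁ ⊆fᵢ) = ⊆fᵢ
    core-F⊆ (inj₂ ((x , x∈ , x∈F , fx≢i) , ⊆F)) = contradiction small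
      (ℕ.<⇒≱ (subst (_< size (core ∩ F)) (Similar.sizes sim i)
        (size-strict (core ∩ fiber f (suc i)) (core ∩ F)
          (λ {z} p → let (q , r) = ∈-∩⁻ core (fiber f (suc i)) {z} p in ∈-∩ core F {z} q (⊆F q (toWitness r)))
          x (∈-∩ core F {x} x∈ x∈F)
          (λ p → fx≢i (toWitness (proj₂ (∈-∩⁻ core (fiber f (suc i)) {x} p)))))))
    F⊆ : ∀ x → x ∈ F → f x ≡ suc i
    F⊆ x x∈F with T? (core x)
    ... | yes x∈ = core-F⊆ cmp x∈ x∈F
    ... | no  x∉ = flooded x∉

  -- Flooding with some `k ≢ i` leaves only core vertices in `Aᵢ`. In the strict case `Aᵢ ∪ {x}`
  -- lies in `F` with `x` made uncovered, so it would be a member, against saturation.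
  member⇒small : ∀ i F → K i F → size (core ∩ F) ≤ m i
  member⇒small i F F∈Kᵢ with third i i
  ... | k , k≢i , _ with align F i k
  ... | f , (sim , flooded) , inj₁ F⊆ = subst (size (core ∩ F) ≤_) (Similar.sizes sim i)
    (size-∩-mono core F (fiber f (suc i)) (λ x∈ x∈F → fromWitness (F⊆ x∈ x∈F)))
  ... | f , (sim , flooded) , inj₂ ((x , x∈ , x∈F , fx≢i) , ⊆F) with uncolour sim flooded x∈ fx≢i
  ...   | g , (sim′ , flooded′) , gx≡0 , same =
    contradiction (IsComplex.closed (complex i) (λ {z} p → sub z (toWitness p)) F∈Kᵢ)
                  (saturated (Similar.crit sim′) gx≡0)
    where
    sub : ∀ z → recolour g x (suc i) z ≡ suc i → z ∈ F
    sub z eq with recolour-cases g eq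
    ... | inj₁ (refl , _) = x∈F
    ... | inj₂ (_ , gz≡i) with T? (core z)
    ...   | yes z∈ = ⊆F z∈ (Equivalence.to (same z) gz≡i)
    ...   | no  z∉ = contradiction (suc-injective (trans (sym (flooded′ z∉)) gz≡i)) k≢i

  member⇔small : ∀ i F → K i F ⇔ size (core ∩ F) ≤ m i
  member⇔small i F = mk⇔ (member⇒small i F) (small⇒member i F)

  -- Count the core by colours in `f₀`; by saturation all `r − 1` uncovered vertices belong to it.
  size-core : size core ≡ ∑.sum m + (2 + s)
  size-core = begin
    size core                              ≡⟨ size-fibers core f₀ ⟩
    size (core ∩ fiber f₀ 0F) + ∑.sum m    ≡⟨ ℕ.+-comm _ (∑.sum m) ⟩
    ∑.sum m + size (core ∩ fiber f₀ 0F)    ≡⟨ cong (∑.sum m +_) (size-∩-⊇ core (fiber f₀ 0F) uncovered∈) ⟩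
    ∑.sum m + size (fiber f₀ 0F)           ≡⟨ cong (∑.sum m +_) (uncovered crit₀) ⟩
    ∑.sum m + (2 + s)                      ∎
    where
    open ≡-Reasoning
    crit₀ : Critical f₀
    crit₀ = proj₂ critical-exists
    uncovered∈ : x ∈ fiber f₀ 0F → x ∈ core
    uncovered∈ p = fromWitness (λ free → saturated crit₀ (toWitness p) (free 0F))

-- Transfer between `V` and `Fin N`

∈-⋃ : {V : Set} (A : Fin n → Subset V) (i : Fin n) {x : V} → x ∈ A i → x ∈ ⋃ A
∈-⋃ A zero    x∈ = Equivalence.from T-∨ (inj₁ x∈)
∈-⋃ A (suc i) x∈ = Equivalence.from T-∨ (inj₂ (∈-⋃ (A ∘ suc) i x∈))

∉-∁ : {V : Set} (A : Subset V) {x : V} → x ∈ ∁ A → ¬ x ∈ A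
∉-∁ A {x} with A x
... | false = λ _ ()
... | true  = λ ()

module Transport
  {V : Set} {N s : ℕ} (enum : V ↔ Fin N) (K : Fin (3 + s) → Family V)
  (complex : ∀ i → IsComplex (K i)) (alexander : IsAlexander enum K)
  where

  open Inverse enum

  K′ : Fin (3 + s) → Family (Fin N)
  K′ i F = K i (F ∘ to)

  complex′ : ∀ i → IsComplex (K′ i)
  complex′ i = record
    { member?  = λ F → member? (F ∘ to)
    ; ∅-member = ∅-member
    ; closed   = λ A⊆B → closed A⊆B
    }
    where open IsComplex (complex i)

  blocks : Colouring s N → Fin (3 + s) → Subset V
  blocks f i = fiber f (suc i) ∘ to

  unavoidable′ : (f : Colouring s N) → ∃[ i ] K′ i (fiber f (suc i))
  unavoidable′ f = IsAlexander.unavoidable alexander (blocks f)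
    (λ i≢j x∈i x∈j → i≢j (suc-injective (trans (sym (toWitness x∈i)) (toWitness x∈j))))

  deficient′ : (f : Colouring s N) → (∀ i → K′ i (fiber f (suc i))) → 2 + s ≤ size (fiber f 0F)
  deficient′ f adm = ℕ.≤-trans (IsAlexander.deficient alexander (blocks f) adm)
    (subst (_≤ size (fiber f 0F)) (sym (∣tabulate∣ uncovered))
      (size-mono uncovered (fiber f 0F) (λ {x} x∈ → fromWitness (is-0 x x∈))))
    where
    uncovered : Subset (Fin N)
    uncovered = ∁ (⋃ (blocks f)) ∘ from
    is-0 : ∀ x → x ∈ uncovered → f x ≡ 0F
    is-0 x x∈ with f x in eq
    ... | zero  = refl
    ... | suc i = contradiction (∈-⋃ (blocks f) i (fromWitness (trans (cong f (strictlyInverseˡ x)) eq)))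
                    (∉-∁ (⋃ (blocks f)) x∈)

  open AlexanderTuple s N K′ complex′ unavoidable′ deficient′ public
    using (core; m; member⇔small; size-core)

  -- `F ∘ from ∘ to` agrees with `F` only pointwise, so closure under subsets is applied in both
  -- directions.
  K⇔K′ : ∀ i F → K i F ⇔ K′ i (F ∘ from)
  K⇔K′ i F = mk⇔
    (IsComplex.closed (complex i) (λ {x} → subst (λ y → T (F y)) (strictlyInverseʳ x)))
    (IsComplex.closed (complex i) (λ {x} → subst (λ y → T (F y)) (sym (strictlyInverseʳ x))))

  K⇔small : ∀ i F → K i F ⇔ size (core ∩ (F ∘ from)) ≤ m i
  K⇔small i F = member⇔small i (F ∘ from) ⇔-∘ K⇔K′ i F

-- Alexander pairs

alexander-pair : {V : Set} {N : ℕ} (enum : V ↔ Fin N) (K : Fin 2 → Family V) →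
                 IsAlexander enum K → K 1F ≐ K 0F °
alexander-pair {V} enum K alexander = ⊆° , °⊆
  where
  -- `∁ F` and `F` partition `V`: deficiency asks for an uncovered vertex and so excludes both
  -- memberships, while unavoidability forces one of them.
  pair : Subset V → Fin 2 → Subset V
  pair F 0F = ∁ F
  pair F 1F = F

  disjoint : ∀ F → PairwiseDisjoint (pair F)
  disjoint F {0F} {0F} i≢i     = contradiction refl i≢i
  disjoint F {0F} {1F} _   p q = ∉-∁ F p q
  disjoint F {1F} {0F} _   p q = ∉-∁ F q p
  disjoint F {1F} {1F} i≢i     = contradiction refl i≢i

  ⊆° : ∀ {F} → K 1F F → ¬ K 0F (∁ F)
  ⊆° {F} F∈K₁ ∁F∈K₀ =
    let (x , x∈) = size-positive uncovered (subst (1 ≤_) (∣tabulate∣ uncovered) deficient)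
    in covered (F (Inverse.from enum x)) x∈
    where
    uncovered : Subset (Fin _)
    uncovered = ∁ (⋃ (pair F)) ∘ Inverse.from enum
    deficient : 1 ≤ card enum (∁ (⋃ (pair F)))
    deficient = IsAlexander.deficient alexander (pair F) (λ { 0F → ∁F∈K₀ ; 1F → F∈K₁ })
    covered : ∀ b → ¬ T (not (not b ∨ b ∨ false))
    covered false ()
    covered true  ()

  °⊆ : ∀ {F} → ¬ K 0F (∁ F) → K 1F F
  °⊆ {F} ∁F∉K₀ with IsAlexander.unavoidable alexander (pair F) (disjoint F)
  ... | 0F , ∁F∈K₀ = contradiction ∁F∈K₀ ∁F∉K₀
  ... | 1F , F∈K₁  = F∈K₁

-- The classification

theorem5p1 : (V : Set) (N : ℕ) (enum : V ↔ Fin N) →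
    (r : ℕ) (K : Fin r → Family V) →
    (∀ i → IsComplex (K i)) →
    (∀ i → Proper (K i)) →
    IsAlexander enum K →
    (Σ[ r≡2 ∈ r ≡ 2 ]
    K (cast (sym r≡2) 1F) ≐ (K (cast (sym r≡2) 0F)) °)
    ⊎ (3 ≤ r ×
    Σ[ φ ∈ V ↔ Fin N ] Σ[ m ∈ (Fin r → ℕ) ]
    N ≡ sum +-0-monoid m + (r ∸ 1) ×
    (∀ i → K i ≅[ φ ] Skeleton N (m i)))
    ⊎ (3 ≤ r ×
    Σ[ n ∈ ℕ ] Σ[ C ∈ Set ] C ×
    Σ[ φ ∈ V ↔ (Fin n ⊎ C) ] Σ[ m ∈ (Fin r → ℕ) ]
    n ≡ sum +-0-monoid m + (r ∸ 1) ×
    (∀ i → K i ≅[ φ ] (Skeleton n (m i) * Simplex C)))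
theorem5p1 V N enum 0 K complex proper alexander with IsAlexander.unavoidable alexander (λ ()) (λ { {()} })
... | () , _
-- For `r = 1` unavoidability puts every subset into the only complex, which is proper.
theorem5p1 V N enum 1 K complex proper alexander = contradiction full (proper 0F)
  where
  full : ∀ A → K 0F A
  full A with IsAlexander.unavoidable alexander (const A) (λ { {0F} {0F} i≢i → contradiction refl i≢i })
  ... | 0F , A∈K₀ = A∈K₀
theorem5p1 V N enum 2 K complex proper alexander = inj₁ (refl , alexander-pair enum K alexander)
-- Cases (2) and (3) differ in whether the core is all of `V`; a vertex outside it makes `C`
-- non-empty.
theorem5p1 V N enum (suc (suc (suc s))) K complex proper alexander
  with any? (λ x → ¬? (T? (Transport.core enum K complex alexander x)))
... | no ∄ = inj₂ (inj₁ (s≤s (s≤s (s≤s z≤n)) , enum , m , trans (sym (size-full core full)) size-core , iso))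
  where
  open Transport enum K complex alexander
  full : ∀ x → x ∈ core
  full x = decidable-stable (T? (core x)) (λ x∉ → ∄ (x , x∉))
  size≡ : ∀ F → size (core ∩ F) ≡ card (↔-id (Fin N)) F
  size≡ F = trans (size-∩-⊇ core F (λ {x} _ → full x)) (sym (∣tabulate∣ F))
  iso : ∀ i → K i ≅[ enum ] Skeleton N (m i)
  iso i F = subst (λ k → K i F ⇔ k ≤ m i) (size≡ (F ∘ Inverse.from enum)) (K⇔small i F)
... | yes (x , x∉) = inj₂ (inj₂ (s≤s (s≤s (s≤s z≤n)) , inside , Fin outside , cone-point ,
                                 split ↔-∘ enum , m , trans (sym size-inside) size-core , iso))
  where
  open Transport enum K complex alexander
  open Split (split-subset core)
  cone-point : Fin outside
  cone-point with Inverse.to split x | Inverse.strictlyInverseʳ split x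
  ... | inj₁ u | refl = contradiction (left∈ u) x∉
  ... | inj₂ v | _    = v
  size≡ : ∀ F → size (core ∩ F) ≡ card (↔-id (Fin inside)) (F ∘ left)
  size≡ F = trans (size-split F) (sym (∣tabulate∣ (F ∘ left)))
  iso : ∀ i → K i ≅[ split ↔-∘ enum ] (Skeleton inside (m i) * Simplex (Fin outside))
  iso i F = mk⇔ to from
    where
    F′ : Subset (Fin N)
    F′ = F ∘ Inverse.from enum
    to : K i F → (Skeleton inside (m i) * Simplex (Fin outside)) (F′ ∘ Inverse.from split)
    to F∈Kᵢ = F′ ∘ left , F′ ∘ right , subst (_≤ m i) (size≡ F′) (Equivalence.to (K⇔small i F) F∈Kᵢ) , tt ,
              λ { (inj₁ _) → refl ; (inj₂ _) → refl }
    from : (Skeleton inside (m i) * Simplex (Fin outside)) (F′ ∘ Inverse.from split) → K i F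
    from (A , B , small , _ , F′≗) = Equivalence.from (K⇔small i F)
      (subst (_≤ m i) (sym (trans (size≡ F′) (cong ∣_∣ (tabulate-cong (F′≗ ∘ inj₁))))) small)
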